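{- For any finite set $P$ of prime numbers, there is a generalized Euclid sequence with seed $P$ that contains every prime number.
   Context: Given a finite set $\{p_1,\ldots,p_k\}$ of distinct primes, for any $I\subseteq\{1,\ldots,k\}$ put $N_I=\prod_{i\in I}p_i+\prod_{i\in\{1,\ldots,k\}\setminus I}p_i$ (empty products equal $1$); $N_I>1$ is coprime to $p_1\cdots p_k$. A generalized Euclid sequence with seed $\{p_1,\ldots,p_k\}$ is an infinite sequence of primes $p_1,p_2,\ldots$ beginning with the seed primes (in some order) such that for every $j\ge k$, $p_{j+1}$ is a prime factor of $N_I$ for some $I\subseteq\{1,\ldots,j\}$ (formed with $p_1,\ldots,p_j$ in place of $p_1,\ldots,p_k$). Equivalently, $p_{j+1}$ is a prime divisor of $d+n/d$ for some positive divisor $d$ of $n=p_1\cdots p_j$. -}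

module Defs where

open import Data.Fin.Base using (Fin; zero; suc; toℕ)
open import Data.Fin.Subset using (Subset; inside; outside; ∁)
open import Data.List.Base using (List; length; applyUpTo)
open import Data.List.Relation.Binary.Permutation.Propositional using (_↭_)
open import Data.Nat.Base using (ℕ; _+_; _*_; _≤_)
open import Data.Nat.Divisibility using (_∣_)
open import Data.Nat.Primality using (Prime)
open import Data.Product.Base using (∃)
open import Data.Vec.Base using ([]; _∷_)
open import Function.Base using (_∘_)

∏ : ∀ {n} → Subset n → (Fin n → ℕ) → ℕ
∏ []            p = 1
∏ (inside  ∷ I) p = p zero * ∏ I (p ∘ suc)
∏ (outside ∷ I) p = ∏ I (p ∘ suc)

N : ∀ {n} → (Fin n → ℕ) → Subset n → ℕ
N p I = ∏ I p + ∏ (∁ I) p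

-- Sequences are indexed from 0, so that p 0 , … , p (j - 1) are the first
-- j terms and p j is the term that follows them.
record IsGeneralizedEuclidSequence (seed : List ℕ) (p : ℕ → ℕ) : Set where
  field
    prime  : ∀ j → Prime (p j)
    begins : applyUpTo p (length seed) ↭ seed
    step   : ∀ j → length seed ≤ j →
             ∃ λ (I : Subset j) → p j ∣ N (λ (i : Fin j) → p (toℕ i)) I

{-# OPTIONS --safe #-}
-- Fix a prime q and a finite set S of primes not containing q, with product n;
-- we adjoin primes to S, one at a time, until q turns up. Let K be a subgroup of
-- (ℤ/q)ˣ all of whose classes are represented by divisors of n. One can always
-- continue so that eventually a prime r ∉ K (possibly r = q) is adjoined:
-- otherwise d + n/d ∈ K, hence d² + n ∈ K, for every divisor d of n in K.
--  * If every element of K is a square in K, then K + n ⊆ K, and iterating the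
--    shift by n puts 0 into K.
--  * If not, first adjoin, by induction, some r ∉ K². If r ∈ K, then
--    K = K² ∪ r K² and -1 ∈ K, and the condition for both n and r n gives
--    1 + n K = K; so K = -K is closed under the shift by -2, and again 0 ∈ K.
-- Apply this to the stabiliser K of the set D of classes of divisors of n.
-- Adjoining r ∉ K enlarges D, so the process stops, which can only be because q
-- has been adjoined. Doing this for all primes in turn gives the sequence.
module Submission where

open import Defs
open import Data.Bool.Base using (true; false)
open import Data.Empty using (⊥; ⊥-elim)
open import Data.Fin.Base using (Fin; toℕ; fromℕ<; punchOut)
import Data.Fin.Base as Fin
import Data.Fin.Properties as Fin
open import Data.Fin.Subset using (Subset; _∈_; _⊆_; _⊂_; _⊃_; inside; outside; ∁; ⊤)
open import Data.Fin.Subset.Properties using (_∈?_; ∈⊤)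
open import Data.Fin.Subset.Induction using (Acc; acc; ⊂-wellFounded; ⊃-wellFounded)
open import Data.Integer.Base using (ℤ; +_; 0ℤ; 1ℤ)
import Data.Integer.Base as ℤ
open import Data.Integer.DivMod using (_/ℕ_; n%ℕd<d; a≡a%ℕn+[a/ℕn]*n)
import Data.Integer.Divisibility.Signed as ℤ
import Data.Integer.Properties as ℤ
open import Data.Integer.Tactic.RingSolver using (solve-∀)
open import Data.List.Base using (List; []; _∷_; length; applyDownFrom)
import Data.List.Membership.DecPropositional as DecMembership
open import Data.List.Membership.Propositional using () renaming (_∈_ to _∈ˡ_)
open import Data.List.Membership.Propositional.Properties using (∈-applyDownFrom⁺; ∈-applyDownFrom⁻)
open import Data.List.Properties using (reverse-applyDownFrom; ∷-injective)
open import Data.List.Relation.Binary.Permutation.Propositional using (↭-trans; ↭-reflexive)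
open import Data.List.Relation.Binary.Permutation.Propositional.Properties using (↭-reverse)
open import Data.List.Relation.Unary.All as All using (All; []; _∷_)
open import Data.List.Relation.Unary.Any using (there)
open import Data.List.Relation.Unary.Unique.Propositional using (Unique)
open import Data.Nat.Base using (ℕ; zero; suc; _≤_; _<_; z≤n; s≤s; NonZero; ≢-nonZero⁻¹)
import Data.Nat.Base as ℕ
import Data.Nat.Divisibility as ℕ
open import Data.Nat.ListAction using (product)
open import Data.Nat.Primality using (Prime; prime?; prime⇒nonZero; euclidsLemma; productOfPrimes≢0)
open import Data.Nat.Primality.Factorisation using (factorise; factorisationHasAllPrimeFactors; module PrimeFactorisation)
import Data.Nat.Properties as ℕ
open import Data.Product.Base using (∃; _×_; _,_; proj₁; proj₂)
open import Data.Sum.Base using (_⊎_; inj₁; inj₂; [_,_]′)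
import Data.Sum.Base as Sum
open import Data.Vec.Base using ([]; _∷_; _∷ʳ_; tabulate)
open import Data.Vec.Properties using (lookup∘tabulate; lookup⇒[]=; []=⇒lookup; map-∷ʳ)
open import Function.Base using (_∘_)
open import Function.Definitions using (Injective)
open import Relation.Binary.Bundles using (Setoid)
open import Relation.Binary.PropositionalEquality using (_≡_; _≢_; refl; sym; trans; cong; cong₂; subst; subst₂; module ≡-Reasoning)
import Relation.Binary.Reasoning.Setoid as SetoidReasoning
open import Relation.Nullary.Decidable using (Dec; yes; no; does; dec-true; _→-dec_; _×-dec_; _⊎-dec_)
open import Relation.Nullary.Negation using (¬_; contradiction)
open import Relation.Unary using (Pred; Decidable)

open DecMembership ℕ._≟_ using () renaming (_∈?_ to _∈ˡ?_)

-- Decidable subsets of a finite set, and the pigeonhole principle.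

module _ {n : ℕ} {p} {P : Pred (Fin n) p} (P? : Decidable P) where

  comprehension : Subset n
  comprehension = tabulate (does ∘ P?)

  ∈-comprehension⁺ : ∀ {x} → P x → x ∈ comprehension
  ∈-comprehension⁺ {x} Px =
    lookup⇒[]= x _ (trans (lookup∘tabulate _ x) (dec-true (P? x) Px))

  ∈-comprehension⁻ : ∀ {x} → x ∈ comprehension → P x
  ∈-comprehension⁻ {x} x∈ with P? x | trans (sym (lookup∘tabulate (does ∘ P?) x)) ([]=⇒lookup x∈)
  ... | yes Px | _ = Px

-- If `y` were missed, deleting it from the codomain would inject `Fin (suc n)` into `Fin n`.
Fin-injective⇒surjective : ∀ {n} {f : Fin n → Fin n} → Injective _≡_ _≡_ f →
                           ∀ y → ∃ λ x → f x ≡ y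
Fin-injective⇒surjective {suc n} {f} f-inj y with Fin.any? (λ x → f x Fin.≟ y)
... | yes hit = hit
... | no  miss = contradiction (Fin.injective⇒≤ punched-inj) ℕ.1+n≰n
  where
  avoids : ∀ x → y ≢ f x
  avoids x y≡fx = miss (x , sym y≡fx)
  punched-inj : Injective _≡_ _≡_ (λ x → punchOut (avoids x))
  punched-inj {x} {x′} eq = f-inj (Fin.punchOut-injective (avoids x) (avoids x′) eq)

-- Extending `f` by the identity outside `K` gives an injection of all of `Fin n`, because `f` keeps
-- `K` inside itself.
injectiveOn⇒surjectiveOn : ∀ {n} (K : Subset n) (f : Fin n → Fin n) →
  (∀ {x} → x ∈ K → f x ∈ K) →
  (∀ {x y} → x ∈ K → y ∈ K → f x ≡ f y → x ≡ y) →
  ∀ {y} → y ∈ K → ∃ λ x → x ∈ K × f x ≡ y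
injectiveOn⇒surjectiveOn K f f∈K f-inj {y} y∈K = restrict (Fin-injective⇒surjective extended-inj y)
  where
  extended : Fin _ → Fin _
  extended x with x ∈? K
  ... | yes _ = f x
  ... | no  _ = x
  extended-inj : Injective _≡_ _≡_ extended
  extended-inj {x} {x′} eq with x ∈? K | x′ ∈? K
  ... | yes x∈K | yes x′∈K = f-inj x∈K x′∈K eq
  ... | yes x∈K | no  x′∉K = contradiction (subst (_∈ K) eq (f∈K x∈K)) x′∉K
  ... | no  x∉K | yes x′∈K = contradiction (subst (_∈ K) (sym eq) (f∈K x′∈K)) x∉K
  ... | no  _   | no  _    = eq
  restrict : (∃ λ x → extended x ≡ y) → ∃ λ x → x ∈ K × f x ≡ y
  restrict (x , eq) with x ∈? K
  ... | yes x∈K = x , x∈K , eq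
  ... | no  x∉K = contradiction (subst (_∈ K) (sym eq) y∈K) x∉K

-- Integer arithmetic modulo the prime `q`.

module Modulo {q : ℕ} (q-prime : Prime q) where

  open import Data.Integer.Base using (-_; _+_; _-_; _*_; ∣_∣; -1ℤ)
  open import Data.Integer.Divisibility.Signed using (_∣_; divides; ∣⇒∣ᵤ; ∣ᵤ⇒∣; ∣m⇒∣-m; ∣m∣n⇒∣m+n; ∣n⇒∣m*n; ∣m⇒∣m*n)

  private instance
    q≢0 : ℕ.NonZero q
    q≢0 = prime⇒nonZero q-prime

  infix 4 _≈_ _≉_ _⋵_ _⋵?_

  -- A record rather than a synonym for the divisibility, so that both sides can be inferred from
  -- the type.
  record _≈_ (a b : ℤ) : Set where
    constructor mk≈
    field q∣a-b : + q ∣ a - b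

  _≉_ : ℤ → ℤ → Set
  a ≉ b = ¬ a ≈ b

  opaque
    ≈-reflexive : ∀ {a b} → a ≡ b → a ≈ b
    ≈-reflexive {a} refl = mk≈ (divides 0ℤ (ℤ.+-inverseʳ a))

    ≈-refl : ∀ {a} → a ≈ a
    ≈-refl = ≈-reflexive refl

    ≈-sym : ∀ {a b} → a ≈ b → b ≈ a
    ≈-sym {a} {b} (mk≈ d) = mk≈ (subst (+ q ∣_) (eq a b) (∣m⇒∣-m d))
      where
      eq : ∀ a b → - (a - b) ≡ b - a
      eq = solve-∀

    ≈-trans : ∀ {a b c} → a ≈ b → b ≈ c → a ≈ c
    ≈-trans {a} {b} {c} (mk≈ d) (mk≈ e) = mk≈ (subst (+ q ∣_) (eq a b c) (∣m∣n⇒∣m+n d e))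
      where
      eq : ∀ a b c → (a - b) + (b - c) ≡ a - c
      eq = solve-∀

  ≈-setoid : Setoid _ _
  ≈-setoid = record
    { Carrier = ℤ ; _≈_ = _≈_
    ; isEquivalence = record { refl = ≈-refl ; sym = ≈-sym ; trans = ≈-trans } }

  open SetoidReasoning ≈-setoid

  opaque
    +-cong : ∀ {a b c d} → a ≈ b → c ≈ d → a + c ≈ b + d
    +-cong {a} {b} {c} {d} (mk≈ e) (mk≈ f) = mk≈ (subst (+ q ∣_) (eq a b c d) (∣m∣n⇒∣m+n e f))
      where
      eq : ∀ a b c d → (a - b) + (c - d) ≡ (a + c) - (b + d)
      eq = solve-∀

    *-cong : ∀ {a b c d} → a ≈ b → c ≈ d → a * c ≈ b * d
    *-cong {a} {b} {c} {d} (mk≈ e) (mk≈ f) =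
      mk≈ (subst (+ q ∣_) (eq a b c d) (∣m∣n⇒∣m+n (∣m⇒∣m*n c e) (∣n⇒∣m*n b f)))
      where
      eq : ∀ a b c d → (a - b) * c + b * (c - d) ≡ a * c - b * d
      eq = solve-∀

    ∣⇒≈0 : ∀ {a} → + q ∣ a → a ≈ 0ℤ
    ∣⇒≈0 {a} = mk≈ ∘ subst (+ q ∣_) (sym (ℤ.+-identityʳ a))

    ≈0⇒∣ : ∀ {a} → a ≈ 0ℤ → + q ∣ a
    ≈0⇒∣ {a} (mk≈ d) = subst (+ q ∣_) (ℤ.+-identityʳ a) d

    ≈0-split : ∀ {a b} → a * b ≈ 0ℤ → a ≈ 0ℤ ⊎ b ≈ 0ℤ
    ≈0-split {a} {b} ab≈0 =
      Sum.map (∣⇒≈0 ∘ ∣ᵤ⇒∣) (∣⇒≈0 ∘ ∣ᵤ⇒∣)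
        (euclidsLemma ∣ a ∣ ∣ b ∣ q-prime (subst (q ℕ.∣_) (ℤ.abs-* a b) (∣⇒∣ᵤ (≈0⇒∣ ab≈0))))

    -≈0⇒≈ : ∀ {a b} → a - b ≈ 0ℤ → a ≈ b
    -≈0⇒≈ = mk≈ ∘ ≈0⇒∣

    ≈⇒-≈0 : ∀ {a b} → a ≈ b → a - b ≈ 0ℤ
    ≈⇒-≈0 (mk≈ d) = ∣⇒≈0 d

    *-cancelʳ : ∀ {a b} c → c ≉ 0ℤ → a * c ≈ b * c → a ≈ b
    *-cancelʳ {a} {b} c c≉0 ac≈bc =
      [ -≈0⇒≈ , (λ c≈0 → contradiction c≈0 c≉0) ]′
        (≈0-split (≈-trans (≈-reflexive (eq a b c)) (≈⇒-≈0 ac≈bc)))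
      where
      eq : ∀ a b c → (a - b) * c ≡ a * c - b * c
      eq = solve-∀

    square-injective-up-to-sign : ∀ {a b} → a * a ≈ b * b → a ≈ b ⊎ a ≈ - b
    square-injective-up-to-sign {a} {b} aa≈bb =
      Sum.map -≈0⇒≈ -≈0⇒≈ (≈0-split (≈-trans (≈-reflexive (eq a b)) (≈⇒-≈0 aa≈bb)))
      where
      eq : ∀ a b → (a - b) * (a - - b) ≡ a * a - b * b
      eq = solve-∀

  ⌜_⌝ : Fin q → ℤ
  ⌜ x ⌝ = + toℕ x

  opaque
    residue : ℤ → Fin q
    residue a = fromℕ< (n%ℕd<d a q)

    ⌜residue⌝ : ∀ a → ⌜ residue a ⌝ ≈ a
    ⌜residue⌝ a = ≈-sym (mk≈ (divides (a /ℕ q)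
      (remainder (a≡a%ℕn+[a/ℕn]*n a q) (cong +_ (Fin.toℕ-fromℕ< (n%ℕd<d a q))))))
      where
      eq : ∀ r t → r + t - r ≡ t
      eq = solve-∀
      remainder : ∀ {a r s t} → a ≡ s + t → r ≡ s → a - r ≡ t
      remainder {r = r} {t = t} refl refl = eq r t

  opaque
    ⌜⌝-injective : ∀ {x y} → ⌜ x ⌝ ≈ ⌜ y ⌝ → x ≡ y
    ⌜⌝-injective {x} {y} (mk≈ d) =
      Fin.toℕ-injective (ℤ.+-injective (ℤ.i-j≡0⇒i≡j ⌜ x ⌝ ⌜ y ⌝ (ℤ.∣i∣≡0⇒i≡0 (small (∣⇒∣ᵤ d) dist<q))))
      where
      dist<q : ∣ ⌜ x ⌝ - ⌜ y ⌝ ∣ ℕ.< q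
      dist<q = ℕ.≤-<-trans
        (subst (λ i → ∣ i ∣ ℕ.≤ toℕ x ℕ.⊔ toℕ y) (sym (ℤ.m-n≡m⊖n (toℕ x) (toℕ y))) (ℤ.∣m⊝n∣≤m⊔n (toℕ x) (toℕ y)))
        (ℕ.⊔-lub (Fin.toℕ<n x) (Fin.toℕ<n y))
      small : ∀ {m} → q ℕ.∣ m → m ℕ.< q → m ≡ 0
      small {zero}  _   _   = refl
      small {suc m} q∣m m<q = contradiction (ℕ.∣⇒≤ q∣m) (ℕ.<⇒≱ m<q)

    residue-cong : ∀ {a b} → a ≈ b → residue a ≡ residue b
    residue-cong {a} {b} a≈b = ⌜⌝-injective (≈-trans (⌜residue⌝ a) (≈-trans a≈b (≈-sym (⌜residue⌝ b))))

    residue-injective : ∀ {a b} → residue a ≡ residue b → a ≈ b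
    residue-injective {a} {b} eq = ≈-trans (≈-sym (⌜residue⌝ a)) (≈-trans (≈-reflexive (cong ⌜_⌝ eq)) (⌜residue⌝ b))

    residue⌜⌝ : ∀ x → residue ⌜ x ⌝ ≡ x
    residue⌜⌝ x = ⌜⌝-injective (⌜residue⌝ ⌜ x ⌝)

  _≈?_ : ∀ a b → Dec (a ≈ b)
  a ≈? b with residue a Fin.≟ residue b
  ... | yes eq = yes (residue-injective eq)
  ... | no neq = no (neq ∘ residue-cong)

  _⋵_ : ℤ → Subset q → Set
  a ⋵ K = residue a ∈ K

  _⋵?_ : ∀ a K → Dec (a ⋵ K)
  a ⋵? K = residue a ∈? K

  ⋵-resp-≈ : ∀ {K a b} → a ≈ b → a ⋵ K → b ⋵ K
  ⋵-resp-≈ {K} a≈b = subst (_∈ K) (residue-cong a≈b)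

  ∈⇒⋵ : ∀ {K x} → x ∈ K → ⌜ x ⌝ ⋵ K
  ∈⇒⋵ {K} {x} = subst (_∈ K) (sym (residue⌜⌝ x))

  opaque
    -- The counting tool behind inverses, square roots and cosets below. The preimage is a canonical
    -- representative because `f` is not assumed to respect `≈`.
    injective⇒surjective : ∀ K (f : ℤ → ℤ) →
      (∀ {a} → a ⋵ K → f a ⋵ K) →
      (∀ {a b} → a ⋵ K → b ⋵ K → f a ≈ f b → a ≈ b) →
      ∀ {b} → b ⋵ K → ∃ λ x → x ∈ K × f ⌜ x ⌝ ≈ b
    injective⇒surjective K f f∈K f-inj b∈K
      with injectiveOn⇒surjectiveOn K (residue ∘ f ∘ ⌜_⌝) (f∈K ∘ ∈⇒⋵)
             (λ x∈K y∈K eq → ⌜⌝-injective (f-inj (∈⇒⋵ x∈K) (∈⇒⋵ y∈K) (residue-injective eq)))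
             b∈K
    ... | x , x∈K , eq = x , x∈K , residue-injective eq

  -- Subgroups of the units modulo `q`, and why the closure conditions on them are contradictory.

  record IsUnitSubmonoid (K : Subset q) : Set where
    field
      1∈K      : 1ℤ ⋵ K
      0∉K      : ¬ 0ℤ ⋵ K
      *-closed : ∀ {a b} → a ⋵ K → b ⋵ K → a * b ⋵ K

  squareOf? : ∀ K → Decidable (λ x → ∃ λ z → z ∈ K × ⌜ z ⌝ * ⌜ z ⌝ ≈ ⌜ x ⌝)
  squareOf? K x = Fin.any? (λ z → z ∈? K ×-dec (⌜ z ⌝ * ⌜ z ⌝) ≈? ⌜ x ⌝)

  squares : Subset q → Subset q
  squares K = comprehension (squareOf? K)

  square∈squares : ∀ {K a} → a ⋵ K → a * a ⋵ squares K
  square∈squares {K} {a} a∈K = ∈-comprehension⁺ (squareOf? K)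
    (residue a , a∈K , ≈-trans (*-cong (⌜residue⌝ a) (⌜residue⌝ a)) (≈-sym (⌜residue⌝ (a * a))))

  ∈squares⇒square : ∀ {K b} → b ⋵ squares K → ∃ λ a → a ⋵ K × a * a ≈ b
  ∈squares⇒square {K} {b} b∈K² with ∈-comprehension⁻ (squareOf? K) b∈K²
  ... | z , z∈K , eq = ⌜ z ⌝ , ∈⇒⋵ z∈K , ≈-trans eq (⌜residue⌝ b)

  module UnitSubmonoid {K : Subset q} (K-sub : IsUnitSubmonoid K) where
    open IsUnitSubmonoid K-sub public

    ⋵⇒≉0 : ∀ {a} → a ⋵ K → a ≉ 0ℤ
    ⋵⇒≉0 a∈K a≈0 = 0∉K (⋵-resp-≈ a≈0 a∈K)

    squares⊆ : ∀ {a} → a ⋵ squares K → a ⋵ K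
    squares⊆ a∈K² with ∈squares⇒square a∈K²
    ... | z , z∈K , zz≈a = ⋵-resp-≈ zz≈a (*-closed z∈K z∈K)

    squares-isUnitSubmonoid : IsUnitSubmonoid (squares K)
    squares-isUnitSubmonoid = record
      { 1∈K = square∈squares {K} {1ℤ} 1∈K
      ; 0∉K = 0∉K ∘ squares⊆
      ; *-closed = closed
      }
      where
      eq : ∀ z w → (z * w) * (z * w) ≡ (z * z) * (w * w)
      eq = solve-∀
      closed : ∀ {a b} → a ⋵ squares K → b ⋵ squares K → a * b ⋵ squares K
      closed a∈K² b∈K² with ∈squares⇒square a∈K² | ∈squares⇒square b∈K²
      ... | z , z∈K , zz≈a | w , w∈K , ww≈b =
        ⋵-resp-≈ (≈-trans (≈-reflexive (eq z w)) (*-cong zz≈a ww≈b)) (square∈squares (*-closed z∈K w∈K))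

    -- Multiplication by `a` is injective on the finite set `K`, hence takes the value 1. So a unit
    -- submonoid is automatically a subgroup of the units.
    inverse : ∀ {a} → a ⋵ K → ∃ λ b → b ⋵ K × b * a ≈ 1ℤ
    inverse {a} a∈K
      with injective⇒surjective K (_* a) (λ b∈K → *-closed b∈K a∈K) (λ _ _ → *-cancelʳ a (⋵⇒≉0 a∈K)) 1∈K
    ... | x , x∈K , eq = ⌜ x ⌝ , ∈⇒⋵ x∈K , eq

    -- Starting from 1, repeated shifts by c reach the class of 0, since c is a unit.
    not-shift-closed : ∀ {c} → c ≉ 0ℤ → ¬ (∀ {a} → a ⋵ K → a + c ⋵ K)
    not-shift-closed {c} c≉0 shift
      with injective⇒surjective ⊤ (_* c) (λ _ → ∈⊤) (λ _ _ → *-cancelʳ c c≉0) { -1ℤ} ∈⊤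
    ... | x , _ , xc≈-1 = 0∉K (⋵-resp-≈ (+-cong (≈-refl {1ℤ}) xc≈-1) (shifts (toℕ x)))
      where
      eq : ∀ j c → 1ℤ + j * c + c ≡ 1ℤ + (1ℤ + j) * c
      eq = solve-∀
      shifts : ∀ j → 1ℤ + + j * c ⋵ K
      shifts zero    = 1∈K
      shifts (suc j) = ⋵-resp-≈ (≈-reflexive (eq (+ j) c)) (shift (shifts j))

    -- If each `a` in `K` is `z * z` with `z` in `K`, then `good` says that `K` is closed under the
    -- shift by `n`.
    not-all-squares : ∀ {n} → n ≉ 0ℤ → (∀ {z} → z ⋵ K → z * z + n ⋵ K) →
                      ¬ (∀ {a} → a ⋵ K → a ⋵ squares K)
    not-all-squares {n} n≉0 good all-squares = not-shift-closed n≉0 shift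
      where
      shift : ∀ {a} → a ⋵ K → a + n ⋵ K
      shift a∈K with ∈squares⇒square (all-squares a∈K)
      ... | z , z∈K , zz≈a = ⋵-resp-≈ (+-cong zz≈a ≈-refl) (good z∈K)

    module NonSquare {r : ℤ} (r∈K : r ⋵ K) (r∉K² : ¬ r ⋵ squares K) where

      -- Injective squaring would be onto `K` by finiteness, making `r` a square.
      not-square-injective : ¬ (∀ {a b} → a ⋵ K → b ⋵ K → a * a ≈ b * b → a ≈ b)
      not-square-injective inj
        with injective⇒surjective K (λ a → a * a) (λ a∈K → *-closed a∈K a∈K) inj r∈K
      ... | x , x∈K , xx≈r = r∉K² (⋵-resp-≈ xx≈r (square∈squares (∈⇒⋵ x∈K)))

      -- If `a ≈ - b` with both in `K`, then dividing by `b` puts -1 into `K`. So without -1, equal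
      -- squares would force `a ≈ b`, and squaring would be injective on `K`.
      -1∈K : -1ℤ ⋵ K
      -1∈K with -1ℤ ⋵? K
      ... | yes -1∈K = -1∈K
      ... | no  -1∉K = ⊥-elim (not-square-injective square-inj)
        where
        square-inj : ∀ {a b} → a ⋵ K → b ⋵ K → a * a ≈ b * b → a ≈ b
        square-inj {a} {b} a∈K b∈K aa≈bb with square-injective-up-to-sign aa≈bb | inverse b∈K
        ... | inj₁ a≈b  | _ = a≈b
        ... | inj₂ a≈-b | b′ , b′∈K , b′b≈1 = contradiction (⋵-resp-≈ (begin
              b′ * a         ≈⟨ *-cong (≈-refl {b′}) a≈-b ⟩
              b′ * - b       ≡⟨ eq b′ b ⟩
              -1ℤ * (b′ * b) ≈⟨ *-cong (≈-refl { -1ℤ}) b′b≈1 ⟩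
              -1ℤ            ∎) (*-closed b′∈K a∈K)) -1∉K
          where
          eq : ∀ x y → x * - y ≡ -1ℤ * (x * y)
          eq = solve-∀

      -- Says that `q` is odd: modulo 2 every `b` equals `- b`, and squaring would be injective.
      -- This makes -2 a legitimate shift in `not-both-good`.
      -2≉0 : - (+ 2) ≉ 0ℤ
      -2≉0 -2≈0 = not-square-injective λ {a} {b} _ _ aa≈bb →
        [ (λ a≈b → a≈b) , (λ a≈-b → ≈-trans a≈-b (neg≈id b)) ]′ (square-injective-up-to-sign aa≈bb)
        where
        eq : ∀ b → - b ≡ b + - (+ 2) * b
        eq = solve-∀
        eq′ : ∀ b → b + 0ℤ * b ≡ b
        eq′ = solve-∀
        neg≈id : ∀ b → - b ≈ b
        neg≈id b = ≈-trans (≈-reflexive (eq b))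
          (≈-trans (+-cong (≈-refl {b}) (*-cong -2≈0 (≈-refl {b}))) (≈-reflexive (eq′ b)))

      -- The squares have index at most two: choosing one of each pair ± a, the
      -- map below is injective, hence onto.
      signed-square : ℤ → ℤ
      signed-square a with residue a Fin.≤? residue (- a)
      ... | yes _ = a * a
      ... | no  _ = r * (a * a)

      signed-square∈K : ∀ {a} → a ⋵ K → signed-square a ⋵ K
      signed-square∈K {a} a∈K with residue a Fin.≤? residue (- a)
      ... | yes _ = *-closed a∈K a∈K
      ... | no  _ = *-closed r∈K (*-closed a∈K a∈K)

      -- Dividing by `b * b` would exhibit `r` as the square of `b′ * a`, where `b′` is the inverse
      -- of `b`.
      square≉r*square : ∀ {a b} → a ⋵ K → b ⋵ K → a * a ≉ r * (b * b)
      square≉r*square {a} {b} a∈K b∈K aa≈rbb with inverse b∈K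
      ... | b′ , b′∈K , b′b≈1 = r∉K² (⋵-resp-≈ (begin
              (b′ * a) * (b′ * a)         ≡⟨ eq b′ a ⟩
              (b′ * b′) * (a * a)         ≈⟨ *-cong (≈-refl {b′ * b′}) aa≈rbb ⟩
              (b′ * b′) * (r * (b * b))   ≡⟨ eq′ b′ r b ⟩
              r * ((b′ * b) * (b′ * b))   ≈⟨ *-cong (≈-refl {r}) (*-cong b′b≈1 b′b≈1) ⟩
              r * 1ℤ                      ≡⟨ ℤ.*-identityʳ r ⟩
              r                           ∎) (square∈squares (*-closed b′∈K a∈K)))
        where
        eq : ∀ x y → (x * y) * (x * y) ≡ (x * x) * (y * y)
        eq = solve-∀
        eq′ : ∀ x y z → (x * x) * (y * (z * z)) ≡ y * ((x * z) * (x * z))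
        eq′ = solve-∀

      neg-swap : ∀ {a b} → a ≈ - b → b ≈ - a
      neg-swap {a} {b} a≈-b = begin
        b           ≡⟨ eq b ⟩
        -1ℤ * - b   ≈⟨ *-cong (≈-refl { -1ℤ}) (≈-sym a≈-b) ⟩
        -1ℤ * a     ≡⟨ ℤ.-1*i≡-i a ⟩
        - a         ∎
        where
        eq : ∀ b → b ≡ -1ℤ * - b
        eq = solve-∀

      -- Different branches cannot meet, by `square≉r*square`. On a common branch only `a ≈ - b` is
      -- in doubt. Then `- a` is `b` and `- b` is `a`, so the two tests compare the same residues in
      -- opposite directions: if both succeed the residues coincide, and both cannot fail.
      signed-square-injective : ∀ {a b} → a ⋵ K → b ⋵ K → signed-square a ≈ signed-square b → a ≈ b
      signed-square-injective {a} {b} a∈K b∈K eq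
        with residue a Fin.≤? residue (- a) | residue b Fin.≤? residue (- b)
      ... | yes a≤-a | no  _    = contradiction eq (square≉r*square a∈K b∈K)
      ... | no  _    | yes _    = contradiction (≈-sym eq) (square≉r*square b∈K a∈K)
      ... | yes a≤-a | yes b≤-b with square-injective-up-to-sign eq
      ...   | inj₁ a≈b  = a≈b
      ...   | inj₂ a≈-b = residue-injective (Fin.≤-antisym
              (subst (residue a Fin.≤_) (residue-cong (≈-sym (neg-swap a≈-b))) a≤-a)
              (subst (residue b Fin.≤_) (residue-cong (≈-sym a≈-b)) b≤-b))
      signed-square-injective {a} {b} a∈K b∈K eq
          | no  a≰-a | no  b≰-b
        with square-injective-up-to-sign (*-cancelʳ r (⋵⇒≉0 r∈K)
               (≈-trans (≈-reflexive (ℤ.*-comm (a * a) r)) (≈-trans eq (≈-reflexive (ℤ.*-comm r (b * b))))))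
      ... | inj₁ a≈b  = a≈b
      ... | inj₂ a≈-b with Fin.≤-total (residue a) (residue b)
      ...   | inj₁ a≤b = contradiction (subst (residue a Fin.≤_) (residue-cong (neg-swap a≈-b)) a≤b) a≰-a
      ...   | inj₂ b≤a = contradiction (subst (residue b Fin.≤_) (residue-cong a≈-b) b≤a) b≰-b

      K≈K²∪rK² : ∀ {b} → b ⋵ K → ∃ λ z → z ⋵ K × (z * z ≈ b ⊎ r * (z * z) ≈ b)
      K≈K²∪rK² b∈K
        with injective⇒surjective K signed-square signed-square∈K signed-square-injective b∈K
      ... | x , x∈K , eq = ⌜ x ⌝ , ∈⇒⋵ x∈K , split eq
        where
        split : ∀ {a b} → signed-square a ≈ b → a * a ≈ b ⊎ r * (a * a) ≈ b
        split {a} eq with residue a Fin.≤? residue (- a)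
        ... | yes _ = inj₁ eq
        ... | no  _ = inj₂ eq

      module _ {n : ℤ} (n≉0 : n ≉ 0ℤ) (good  : ∀ {z} → z ⋵ K → z * z + n ⋵ K)
               (good′ : ∀ {z} → z ⋵ K → z * z + r * n ⋵ K) where

        opaque
          -- Apply `good` to the inverse of `z`, then multiply by `z * z`.
          rescale : ∀ {m z} → (∀ {z} → z ⋵ K → z * z + m ⋵ K) → z ⋵ K → 1ℤ + m * (z * z) ⋵ K
          rescale {m} {z} good z∈K with inverse z∈K
          ... | z′ , z′∈K , z′z≈1 = ⋵-resp-≈ (begin
                (z′ * z′ + m) * (z * z)               ≡⟨ eq z′ z m ⟩
                (z′ * z) * (z′ * z) + m * (z * z)     ≈⟨ +-cong (*-cong z′z≈1 z′z≈1) ≈-refl ⟩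
                1ℤ + m * (z * z)                      ∎) (*-closed (good z′∈K) (*-closed z∈K z∈K))
            where
            eq : ∀ x y m → (x * x + m) * (y * y) ≡ (x * y) * (x * y) + m * (y * y)
            eq = solve-∀

          -- Each coset of the squares has its own hypothesis: `good` serves `x ≈ z * z`, and
          -- `good′` serves `x ≈ r * (z * z)`, since the factor `r` can be moved from `x` to `n`.
          1+n*K⊆K : ∀ {x} → x ⋵ K → 1ℤ + n * x ⋵ K
          1+n*K⊆K {x} x∈K with K≈K²∪rK² x∈K
          ... | z , z∈K , inj₁ zz≈x  = ⋵-resp-≈ (+-cong (≈-refl {1ℤ}) (*-cong (≈-refl {n}) zz≈x)) (rescale good z∈K)
          ... | z , z∈K , inj₂ rzz≈x = ⋵-resp-≈ (+-cong (≈-refl {1ℤ}) (≈-trans (≈-reflexive (eq r n z))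
                                          (*-cong (≈-refl {n}) rzz≈x))) (rescale good′ z∈K)
            where
            eq : ∀ r n z → r * n * (z * z) ≡ n * (r * (z * z))
            eq = solve-∀

          1+n*-injective : ∀ {a b} → 1ℤ + n * a ≈ 1ℤ + n * b → a ≈ b
          1+n*-injective {a} {b} eq = *-cancelʳ n n≉0 (begin
            a * n                     ≡⟨ eq′ a n ⟩
            -1ℤ + (1ℤ + n * a)        ≈⟨ +-cong (≈-refl { -1ℤ}) eq ⟩
            -1ℤ + (1ℤ + n * b)        ≡⟨ eq′ b n ⟨
            b * n                     ∎)
            where
            eq′ : ∀ a n → a * n ≡ -1ℤ + (1ℤ + n * a)
            eq′ = solve-∀

        -- x ↦ 1 + n x permutes K, and -1 + n x = - (1 + n (- x)), so K would be
        -- closed under subtracting 2.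
        not-both-good : ⊥
        not-both-good = not-shift-closed -2≉0 shift
          where
          shift : ∀ {a} → a ⋵ K → a + - (+ 2) ⋵ K
          shift {a} a∈K with injective⇒surjective K (λ x → 1ℤ + n * x) 1+n*K⊆K (λ _ _ → 1+n*-injective) a∈K
          ... | x , x∈K , eq = ⋵-resp-≈ (begin
                -1ℤ * (1ℤ + n * (-1ℤ * ⌜ x ⌝))   ≡⟨ eq′ n ⌜ x ⌝ ⟩
                1ℤ + n * ⌜ x ⌝ + - (+ 2)         ≈⟨ +-cong eq (≈-refl { - (+ 2)}) ⟩
                a + - (+ 2)                      ∎)
                (*-closed -1∈K (1+n*K⊆K (*-closed -1∈K (∈⇒⋵ x∈K))))
            where
            eq′ : ∀ n x → -1ℤ * (1ℤ + n * (-1ℤ * x)) ≡ 1ℤ + n * x + - (+ 2)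
            eq′ = solve-∀

-- Growing a finite list of primes by admissible steps.

open import Data.Nat.Base using (_+_; _*_; _∸_)
open import Data.Nat.Divisibility using (_∣_; ∣-trans; m∣m*n; n∣m*n)

-- Lists of primes are kept with the most recent prime first.
data Split : List ℕ → ℕ → ℕ → Set where
  []    : Split [] 1 1
  left  : ∀ {r S d e} → Split S d e → Split (r ∷ S) (r * d) e
  right : ∀ {r S d e} → Split S d e → Split (r ∷ S) d (r * e)

split-product : ∀ {S d e} → Split S d e → d * e ≡ product S
split-product []                            = refl
split-product (left {r} {_} {d} {e} split)  = trans (ℕ.*-assoc r d e) (cong (r *_) (split-product split))
split-product (right {r} {S} {d} {e} split) = begin
  d * (r * e)  ≡⟨ ℕ.*-assoc d r e ⟨
  d * r * e    ≡⟨ cong (_* e) (ℕ.*-comm d r) ⟩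
  r * d * e    ≡⟨ ℕ.*-assoc r d e ⟩
  r * (d * e)  ≡⟨ cong (r *_) (split-product split) ⟩
  r * product S ∎
  where open ≡-Reasoning

Successor : List ℕ → ℕ → Set
Successor S r = Prime r × ∃ λ d → ∃ λ e → Split S d e × r ∣ d + e

infix 4 _⟶*_

data _⟶*_ (S : List ℕ) : List ℕ → Set where
  done : S ⟶* S
  grow : ∀ {T r} → S ⟶* T → Successor T r → S ⟶* (r ∷ T)

⟶*-trans : ∀ {S T U} → S ⟶* T → T ⟶* U → S ⟶* U
⟶*-trans p done       = p
⟶*-trans p (grow q s) = grow (⟶*-trans p q) s

⟶*-primes : ∀ {S T} → All Prime S → S ⟶* T → All Prime T
⟶*-primes ps done             = ps
⟶*-primes ps (grow p (r , _)) = r ∷ ⟶*-primes ps p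

⟶*-length : ∀ {S T} → S ⟶* T → length S ≤ length T
⟶*-length done       = ℕ.≤-refl
⟶*-length (grow p _) = ℕ.m≤n⇒m≤1+n (⟶*-length p)

-- All later primes go to the complementary side, so the divisor `d` itself is unchanged.
⟶*-split : ∀ {S T d e} → S ⟶* T → Split S d e → ∃ λ e′ → Split T d e′
⟶*-split done       split = _ , split
⟶*-split (grow p _) split = _ , right (proj₂ (⟶*-split p split))

split-one : ∀ S → Split S 1 (product S)
split-one []      = []
split-one (r ∷ S) = right (split-one S)

-- Take `d = 1`: as `product S` is nonzero, `1 + product S` exceeds 1 and has a prime factor.
successor-exists : ∀ {S} → All Prime S → ∃ (Successor S)
successor-exists {S} S-prime with factorise (1 + product S)
... | record { factors = [] ; isFactorisation = eq } =
  contradiction (ℕ.suc-injective eq) (≢-nonZero⁻¹ _ {{productOfPrimes≢0 S-prime}})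
... | record { factors = r ∷ rs ; isFactorisation = eq ; factorsPrime = r-prime ∷ _ } =
  r , r-prime , 1 , product S , split-one S , subst (r ∣_) (sym eq) (m∣m*n (product rs))

⊎-sequence : ∀ {n} {A B : Fin n → Set} → (∀ x → A x ⊎ B x) → ∃ A ⊎ (∀ x → B x)
⊎-sequence {zero}  f = inj₂ λ ()
⊎-sequence {suc n} f with f Fin.zero | ⊎-sequence (f ∘ Fin.suc)
... | inj₁ a | _            = inj₁ (Fin.zero , a)
... | inj₂ _ | inj₁ (x , a) = inj₁ (Fin.suc x , a)
... | inj₂ b | inj₂ bs      = inj₂ λ { Fin.zero → b ; (Fin.suc x) → bs x }

-- Forcing a given prime `q` to appear.

module Reach {q : ℕ} (q-prime : Prime q) where
  open Modulo q-prime

  Reachable : List ℕ → Set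
  Reachable S = ∃ λ T → S ⟶* T × q ∈ˡ T

  Covers : List ℕ → Subset q → Set
  Covers S K = ∀ {x} → x ∈ K → ∃ λ d → ∃ λ e → Split S d e × + d ≈ ⌜ x ⌝

  product≉0 : ∀ {S} → All Prime S → ¬ q ∈ˡ S → + product S ≉ 0ℤ
  product≉0 S-prime q∉S n≈0 = q∉S (factorisationHasAllPrimeFactors q-prime (ℤ.∣⇒∣ᵤ (≈0⇒∣ n≈0)) S-prime)

  module _ {K : Subset q} (K-sub : IsUnitSubmonoid K) where
    open UnitSubmonoid K-sub

    -- `K` is closed under products, so a product of primes all in `K` would lie in `K`.
    factor∉K : ∀ {rs} → All Prime rs → ¬ + product rs ⋵ K →
               ∃ λ r → Prime r × r ∣ product rs × ¬ + r ⋵ K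
    factor∉K []                  1∉K = contradiction 1∈K 1∉K
    factor∉K {r ∷ rs} (r-prime ∷ rs-prime) n∉K with + r ⋵? K
    ... | no  r∉K = r , r-prime , m∣m*n (product rs) , r∉K
    ... | yes r∈K with factor∉K rs-prime
                         (λ m∈K → n∉K (⋵-resp-≈ (≈-reflexive (sym (ℤ.pos-* r (product rs)))) (*-closed r∈K m∈K)))
    ...   | p , p-prime , p∣m , p∉K = p , p-prime , ∣-trans p∣m (n∣m*n r) , p∉K

    prime-factor∉K : ∀ n → .{{NonZero n}} → ¬ + n ⋵ K → ∃ λ r → Prime r × r ∣ n × ¬ + r ⋵ K
    prime-factor∉K n n∉K = subst (λ m → ∃ λ r → Prime r × r ∣ m × ¬ + r ⋵ K) (sym isFactorisation)
      (factor∉K factorsPrime (subst (λ m → ¬ + m ⋵ K) isFactorisation n∉K))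
      where open PrimeFactorisation (factorise n)

    -- Let the divisor `d` represent `z`, with cofactor `e`. If `d + e` is outside `K`, so is one of
    -- its prime factors, which is a successor. Otherwise `d * (d + e)`, that is
    -- `d * d + product S`, lies in `K`.
    successor∉K-or-good : ∀ {S} → All Prime S → Covers S K →
      (∃ λ r → Successor S r × ¬ + r ⋵ K) ⊎ (∀ {z} → z ⋵ K → z ℤ.* z ℤ.+ + product S ⋵ K)
    successor∉K-or-good {S} S-prime covers = Sum.map proj₂ extend (⊎-sequence test)
      where
      SuccessorOutside : Set
      SuccessorOutside = ∃ λ r → Successor S r × ¬ + r ⋵ K

      extend : (∀ x → x ∈ K → ⌜ x ⌝ ℤ.* ⌜ x ⌝ ℤ.+ + product S ⋵ K) →
               ∀ {z} → z ⋵ K → z ℤ.* z ℤ.+ + product S ⋵ K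
      extend good {z} z∈K =
        ⋵-resp-≈ (+-cong (*-cong (⌜residue⌝ z) (⌜residue⌝ z)) (≈-refl {+ product S})) (good (residue z) z∈K)

      sum≢0 : ∀ {d e} → Split S d e → NonZero (d + e)
      sum≢0 {zero} split  = contradiction (sym (split-product split)) (≢-nonZero⁻¹ _ {{productOfPrimes≢0 S-prime}})
      sum≢0 {suc _} split = _

      sum-formula : ∀ {d e} → Split S d e → + d ℤ.* + (d + e) ≡ + d ℤ.* + d ℤ.+ + product S
      sum-formula {d} {e} split = begin
        + d ℤ.* (+ d ℤ.+ + e)        ≡⟨ ℤ.*-distribˡ-+ (+ d) (+ d) (+ e) ⟩
        + d ℤ.* + d ℤ.+ + d ℤ.* + e  ≡⟨ cong (λ n → + d ℤ.* + d ℤ.+ n) (ℤ.pos-* d e) ⟨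
        + d ℤ.* + d ℤ.+ + (d * e)    ≡⟨ cong (λ n → + d ℤ.* + d ℤ.+ + n) (split-product split) ⟩
        + d ℤ.* + d ℤ.+ + product S  ∎
        where open ≡-Reasoning

      test : ∀ x → SuccessorOutside ⊎ (x ∈ K → ⌜ x ⌝ ℤ.* ⌜ x ⌝ ℤ.+ + product S ⋵ K)
      test x with x ∈? K
      ... | no  x∉K = inj₂ (λ x∈K → contradiction x∈K x∉K)
      ... | yes x∈K with covers x∈K
      ...   | d , e , split , d≈x with + (d + e) ⋵? K
      ...     | yes N∈K = inj₂ (λ _ → ⋵-resp-≈
                  (≈-trans (≈-reflexive (sum-formula split)) (+-cong (*-cong d≈x d≈x) (≈-refl {+ product S})))
                  (*-closed (⋵-resp-≈ (≈-sym d≈x) (∈⇒⋵ x∈K)) N∈K))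
      ...     | no  N∉K with prime-factor∉K (d + e) {{sum≢0 split}} N∉K
      ...       | r , r-prime , r∣N , r∉K = inj₁ (r , (r-prime , d , e , split , r∣N) , r∉K)

  Covers-⟶* : ∀ {S T K} → S ⟶* T → Covers S K → Covers T K
  Covers-⟶* p covers x∈K with covers x∈K
  ... | d , _ , split , d≈x = d , _ , proj₂ (⟶*-split p split) , d≈x

  Escape : List ℕ → Subset q → Set
  Escape S K = ∃ λ T → ∃ λ r → S ⟶* T × Successor T r × ¬ + r ⋵ K

  -- Induction on `K` under strict inclusion: when `squares K` is a proper subset, the recursive
  -- call either reaches `q` or supplies a successor `r` outside `squares K`.
  escape : ∀ {K} → Acc _⊂_ K → IsUnitSubmonoid K → ∀ {S} → All Prime S → Covers S K →
           Reachable S ⊎ Escape S K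
  escape {K} (acc rec) K-sub {S} S-prime covers with q ∈ˡ? S
  ... | yes q∈S = inj₁ (S , done , q∈S)
  ... | no  q∉S with Fin.all? (λ x → x ∈? K →-dec x ∈? squares K)
  ...   | yes K⊆K² with successor∉K-or-good K-sub S-prime covers
  ...     | inj₁ (r , succ , r∉K) = inj₂ (S , r , done , succ , r∉K)
  ...     | inj₂ good = ⊥-elim (not-all-squares (product≉0 S-prime q∉S) good (λ {a} → K⊆K² (residue a)))
    where open UnitSubmonoid K-sub
  escape {K} (acc rec) K-sub {S} S-prime covers | no q∉S | no K⊈K²
    with escape (rec K²⊂K) squares-isUnitSubmonoid S-prime (covers ∘ K²⊆K)
    where
    open UnitSubmonoid K-sub
    K²⊆K : squares K ⊆ K
    K²⊆K {x} x∈K² = subst (_∈ K) (residue⌜⌝ x) (squares⊆ (∈⇒⋵ x∈K²))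
    K²⊂K : squares K ⊂ K
    K²⊂K with Fin.¬∀⟶∃¬ q _ (λ x → x ∈? K →-dec x ∈? squares K) K⊈K²
    ... | x , ¬x∈K→x∈K² with x ∈? K
    ...   | yes x∈K = K²⊆K , x , x∈K , (λ x∈K² → ¬x∈K→x∈K² (λ _ → x∈K²))
    ...   | no  x∉K = contradiction (λ x∈K → contradiction x∈K x∉K) ¬x∈K→x∈K²
  ... | inj₁ reachable = inj₁ reachable
  ... | inj₂ (T , r , path , succ , r∉K²) with + r ⋵? K | q ∈ˡ? T
  ...   | no  r∉K | _       = inj₂ (T , r , path , succ , r∉K)
  ...   | yes _   | yes q∈T = inj₁ (T , path , q∈T)
  ...   | yes r∈K | no  q∉T
    -- The alternative is tested before and after adjoining `r`, when the products are `n` and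
    -- `r * n`. If neither list has a successor outside `K`, these are the two conditions that
    -- `not-both-good` refutes.
    with successor∉K-or-good K-sub (⟶*-primes S-prime path) (Covers-⟶* path covers)
       | successor∉K-or-good K-sub (⟶*-primes S-prime (grow path succ)) (Covers-⟶* (grow path succ) covers)
  ...     | inj₁ (r′ , succ′ , r′∉K) | _ = inj₂ (T , r′ , path , succ′ , r′∉K)
  ...     | inj₂ _ | inj₁ (r′ , succ′ , r′∉K) = inj₂ (r ∷ T , r′ , grow path succ , succ′ , r′∉K)
  ...     | inj₂ good | inj₂ good′ = ⊥-elim (not-both-good (product≉0 (⟶*-primes S-prime path) q∉T) good
              (λ {z} z∈K → ⋵-resp-≈ (≈-reflexive (cong (λ n → z ℤ.* z ℤ.+ n) (ℤ.pos-* r (product T)))) (good′ z∈K)))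
    where
    open UnitSubmonoid K-sub
    open NonSquare r∈K r∉K²

  multipleOf? : ∀ r D → Decidable (λ x → x ∈ D ⊎ ∃ λ y → y ∈ D × + r ℤ.* ⌜ y ⌝ ≈ ⌜ x ⌝)
  multipleOf? r D x = x ∈? D ⊎-dec Fin.any? (λ y → y ∈? D ×-dec (+ r ℤ.* ⌜ y ⌝) ≈? ⌜ x ⌝)

  -- Kept as a subset of the finite set of residues, so that its strict growth can drive the
  -- induction in `reach`.
  divisorClasses : List ℕ → Subset q
  divisorClasses []      = comprehension (λ x → ⌜ x ⌝ ≈? 1ℤ)
  divisorClasses (r ∷ S) = comprehension (multipleOf? r (divisorClasses S))

  1∈divisorClasses : ∀ S → 1ℤ ⋵ divisorClasses S
  1∈divisorClasses []      = ∈-comprehension⁺ (λ x → ⌜ x ⌝ ≈? 1ℤ) (⌜residue⌝ 1ℤ)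
  1∈divisorClasses (r ∷ S) = ∈-comprehension⁺ (multipleOf? r (divisorClasses S)) (inj₁ (1∈divisorClasses S))

  Covers-divisorClasses : ∀ S → Covers S (divisorClasses S)
  Covers-divisorClasses [] x∈D = 1 , 1 , [] , ≈-sym (∈-comprehension⁻ (λ x → ⌜ x ⌝ ≈? 1ℤ) x∈D)
  Covers-divisorClasses (r ∷ S) x∈D with ∈-comprehension⁻ (multipleOf? r (divisorClasses S)) x∈D
  ... | inj₁ x∈D′ with Covers-divisorClasses S x∈D′
  ...   | d , e , split , d≈x = d , r * e , right split , d≈x
  Covers-divisorClasses (r ∷ S) x∈D | inj₂ (y , y∈D , ry≈x) with Covers-divisorClasses S y∈D
  ...   | d , e , split , d≈y = r * d , e , left split ,
            ≈-trans (≈-reflexive (ℤ.pos-* r d)) (≈-trans (*-cong (≈-refl {+ r}) d≈y) ry≈x)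

  divisorClasses-multiple : ∀ {r S a} → a ⋵ divisorClasses S → + r ℤ.* a ⋵ divisorClasses (r ∷ S)
  divisorClasses-multiple {r} {S} {a} a∈D = ∈-comprehension⁺ (multipleOf? r (divisorClasses S))
    (inj₂ (residue a , a∈D , ≈-trans (*-cong (≈-refl {+ r}) (⌜residue⌝ a)) (≈-sym (⌜residue⌝ (+ r ℤ.* a)))))

  divisorClasses-⟶* : ∀ {S T} → S ⟶* T → divisorClasses S ⊆ divisorClasses T
  divisorClasses-⟶* done x∈D = x∈D
  divisorClasses-⟶* (grow {T} {r} p _) x∈D =
    ∈-comprehension⁺ (multipleOf? r (divisorClasses T)) (inj₁ (divisorClasses-⟶* p x∈D))

  0∉divisorClasses : ∀ {S} → All Prime S → ¬ q ∈ˡ S → ¬ 0ℤ ⋵ divisorClasses S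
  0∉divisorClasses {S} S-prime q∉S 0∈D with Covers-divisorClasses S 0∈D
  ... | d , e , split , d≈0 = product≉0 S-prime q∉S (≈-trans
    (≈-reflexive (trans (cong +_ (sym (split-product split))) (ℤ.pos-* d e)))
    (*-cong (≈-trans d≈0 (⌜residue⌝ 0ℤ)) (≈-refl {+ e})))

  stabilises? : ∀ D → Decidable (λ x → ∀ y → y ∈ D → ⌜ x ⌝ ℤ.* ⌜ y ⌝ ⋵ D)
  stabilises? D x = Fin.all? (λ y → y ∈? D →-dec (⌜ x ⌝ ℤ.* ⌜ y ⌝) ⋵? D)

  stabiliser : Subset q → Subset q
  stabiliser D = comprehension (stabilises? D)

  stabiliser⁻ : ∀ {D a b} → a ⋵ stabiliser D → b ⋵ D → a ℤ.* b ⋵ D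
  stabiliser⁻ {D} {a} {b} a∈H b∈D =
    ⋵-resp-≈ (*-cong (⌜residue⌝ a) (⌜residue⌝ b)) (∈-comprehension⁻ (stabilises? D) a∈H (residue b) b∈D)

  stabiliser⁺ : ∀ {D a} → (∀ {b} → b ⋵ D → a ℤ.* b ⋵ D) → a ⋵ stabiliser D
  stabiliser⁺ {D} {a} stab = ∈-comprehension⁺ (stabilises? D)
    (λ y y∈D → ⋵-resp-≈ (*-cong (≈-sym (⌜residue⌝ a)) (≈-refl {⌜ y ⌝})) (stab (∈⇒⋵ y∈D)))

  -- Multiply `a` into the member 1 of `D`. Through this the stabiliser of the divisor classes
  -- inherits their representatives, as `Covers` demands.
  stabiliser⊆ : ∀ {D a} → 1ℤ ⋵ D → a ⋵ stabiliser D → a ⋵ D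
  stabiliser⊆ {D} {a} 1∈D a∈H = ⋵-resp-≈ (≈-reflexive (ℤ.*-identityʳ a)) (stabiliser⁻ a∈H 1∈D)

  stabiliser-isUnitSubmonoid : ∀ {D} → 1ℤ ⋵ D → ¬ 0ℤ ⋵ D → IsUnitSubmonoid (stabiliser D)
  stabiliser-isUnitSubmonoid {D} 1∈D 0∉D = record
    { 1∈K = stabiliser⁺ {a = 1ℤ} (λ {b} → ⋵-resp-≈ (≈-reflexive (sym (ℤ.*-identityˡ b))))
    ; 0∉K = 0∉D ∘ stabiliser⊆ {a = 0ℤ} 1∈D
    ; *-closed = λ {a} {b} a∈H b∈H → stabiliser⁺ {a = a ℤ.* b} (λ {c} c∈D →
        ⋵-resp-≈ (≈-reflexive (sym (ℤ.*-assoc a b c))) (stabiliser⁻ {a = a} a∈H (stabiliser⁻ {a = b} b∈H c∈D)))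
    }

  ∉stabiliser : ∀ {D a} → ¬ a ⋵ stabiliser D → ∃ λ y → y ∈ D × ¬ a ℤ.* ⌜ y ⌝ ⋵ D
  ∉stabiliser {D} {a} a∉H with Fin.¬∀⟶∃¬ q _ (λ y → y ∈? D →-dec (a ℤ.* ⌜ y ⌝) ⋵? D)
    (λ stab → a∉H (stabiliser⁺ {a = a} (λ {b} b∈D →
      ⋵-resp-≈ (*-cong (≈-refl {a}) (⌜residue⌝ b)) (stab (residue b) b∈D))))
  ... | y , ¬stab with y ∈? D
  ...   | yes y∈D = y , y∈D , (λ ay∈D → ¬stab (λ _ → ay∈D))
  ...   | no  y∉D = contradiction (λ y∈D → contradiction y∈D y∉D) ¬stab

  -- Induction on the set of divisor classes under reverse strict inclusion. If the escaping prime
  -- `r` is `q` itself, the recursive call stops at once.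
  reach : ∀ {S} → Acc _⊃_ (divisorClasses S) → All Prime S → Reachable S
  reach {S} (acc rec) S-prime with q ∈ˡ? S
  ... | yes q∈S = S , done , q∈S
  ... | no  q∉S with escape (⊂-wellFounded _)
                       (stabiliser-isUnitSubmonoid (1∈divisorClasses S) (0∉divisorClasses S-prime q∉S))
                       S-prime
                       (λ {x} x∈H → Covers-divisorClasses S
                         (subst (_∈ divisorClasses S) (residue⌜⌝ x) (stabiliser⊆ (1∈divisorClasses S) (∈⇒⋵ x∈H))))
  ...   | inj₁ reachable = reachable
  ...   | inj₂ (T , r , path , succ , r∉H) with reach (rec larger) (⟶*-primes S-prime (grow path succ))
    where
    -- As `r` does not stabilise the old classes, it moves some old class `y` out of them. Since `y`
    -- is still a divisor class of `T`, its multiple by `r` is one of `r ∷ T`.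
    larger : divisorClasses (r ∷ T) ⊃ divisorClasses S
    larger with ∉stabiliser {a = + r} r∉H
    ... | y , y∈D , ry∉D = divisorClasses-⟶* (grow path succ) ,
      residue (+ r ℤ.* ⌜ y ⌝) , divisorClasses-multiple {r} {T} (∈⇒⋵ (divisorClasses-⟶* path y∈D)) , ry∉D
  ...     | U , path′ , q∈U = U , ⟶*-trans (grow path succ) path′ , q∈U

reach-prime : ∀ {q S} → Prime q → All Prime S → ∃ λ T → S ⟶* T × q ∈ˡ T
reach-prime q-prime = Reach.reach q-prime (⊃-wellFounded _)

-- From lists of primes to terms of a sequence and subsets of indices.

-- Indexed from the end of the list, with junk value 0 out of range.
nth : List ℕ → ℕ → ℕ
nth []       j = 0
nth (r ∷ S) j with j ℕ.≟ length S
... | yes _ = r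
... | no  _ = nth S j

-- Primes are added at the front while positions count from the end, so old entries keep their
-- index.
nth-stable : ∀ {S T j} → S ⟶* T → j < length S → nth T j ≡ nth S j
nth-stable done j<S = refl
nth-stable {S} {r ∷ T} {j} (grow p _) j<S with j ℕ.≟ length T
... | yes refl = contradiction (⟶*-length p) (ℕ.<⇒≱ j<S)
... | no  _    = nth-stable p j<S

applyDownFrom-nth : ∀ (p : ℕ → ℕ) S → (∀ {j} → j < length S → p j ≡ nth S j) → applyDownFrom p (length S) ≡ S
applyDownFrom-nth p []      _  = refl
applyDownFrom-nth p (r ∷ S) eq = cong₂ _∷_ head (applyDownFrom-nth p S tail)
  where
  head : p (length S) ≡ r
  head with length S ℕ.≟ length S | eq {length S} ℕ.≤-refl
  ... | yes _ | p≡r = p≡r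
  ... | no ≢  | _   = contradiction refl ≢
  tail : ∀ {j} → j < length S → p j ≡ nth S j
  tail {j} j<S with j ℕ.≟ length S | eq (ℕ.m≤n⇒m≤1+n j<S)
  ... | yes refl | _    = contradiction refl (ℕ.<⇒≢ j<S)
  ... | no  _    | p≡nth = p≡nth

-- `∏` peels off the first index, but a split of `applyDownFrom p` peels off the latest term, so its
-- choice has to be appended at the far end of the subset.
∏-∷ʳ-inside : ∀ {n} (p : ℕ → ℕ) (I : Subset n) → ∏ (I ∷ʳ inside) (p ∘ toℕ) ≡ p n * ∏ I (p ∘ toℕ)
∏-∷ʳ-inside p []            = refl
∏-∷ʳ-inside {suc n} p (true ∷ I)  = begin
  p 0 * ∏ (I ∷ʳ inside) (p ∘ suc ∘ toℕ)   ≡⟨ cong (p 0 *_) (∏-∷ʳ-inside (p ∘ suc) I) ⟩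
  p 0 * (p (suc n) * ∏ I (p ∘ suc ∘ toℕ)) ≡⟨ ℕ.*-assoc (p 0) _ _ ⟨
  p 0 * p (suc n) * ∏ I (p ∘ suc ∘ toℕ)   ≡⟨ cong (_* ∏ I (p ∘ suc ∘ toℕ)) (ℕ.*-comm (p 0) _) ⟩
  p (suc n) * p 0 * ∏ I (p ∘ suc ∘ toℕ)   ≡⟨ ℕ.*-assoc (p (suc n)) _ _ ⟩
  p (suc n) * (p 0 * ∏ I (p ∘ suc ∘ toℕ)) ∎
  where open ≡-Reasoning
∏-∷ʳ-inside p (false ∷ I) = ∏-∷ʳ-inside (p ∘ suc) I

∏-∷ʳ-outside : ∀ {n} (p : ℕ → ℕ) (I : Subset n) → ∏ (I ∷ʳ outside) (p ∘ toℕ) ≡ ∏ I (p ∘ toℕ)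
∏-∷ʳ-outside p []          = refl
∏-∷ʳ-outside p (true ∷ I)  = cong (p 0 *_) (∏-∷ʳ-outside (p ∘ suc) I)
∏-∷ʳ-outside p (false ∷ I) = ∏-∷ʳ-outside (p ∘ suc) I

split⇒subset : ∀ (p : ℕ → ℕ) j {d e} → Split (applyDownFrom p j) d e →
               ∃ λ (I : Subset j) → ∏ I (p ∘ toℕ) ≡ d × ∏ (∁ I) (p ∘ toℕ) ≡ e
split⇒subset p zero [] = [] , refl , refl
split⇒subset p (suc j) (left split) with split⇒subset p j split
... | I , refl , refl = I ∷ʳ inside , ∏-∷ʳ-inside p I ,
      trans (cong (λ J → ∏ J (p ∘ toℕ)) (map-∷ʳ _ inside I)) (∏-∷ʳ-outside p (∁ I))
split⇒subset p (suc j) (right split) with split⇒subset p j split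
... | I , refl , refl = I ∷ʳ outside , ∏-∷ʳ-outside p I ,
      trans (cong (λ J → ∏ J (p ∘ toℕ)) (map-∷ʳ _ outside I)) (∏-∷ʳ-inside p (∁ I))

-- Walk back along the path to the `grow` that was applied to a list of length `j`; its split yields
-- the subset.
⟶*-step : ∀ {S T} (p : ℕ → ℕ) {j} → S ⟶* T → applyDownFrom p (length T) ≡ T →
          length S ≤ j → j < length T → ∃ λ (I : Subset j) → p j ∣ N (λ (i : Fin j) → p (toℕ i)) I
⟶*-step p done eq S≤j j<T = contradiction S≤j (ℕ.<⇒≱ j<T)
⟶*-step {S} {r ∷ T} p {j} (grow path (_ , d , e , split , r∣d+e)) eq S≤j (s≤s j≤T) with j ℕ.≟ length T
... | no  j≢T = ⟶*-step p path (proj₂ (∷-injective eq)) S≤j (ℕ.≤∧≢⇒< j≤T j≢T)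
... | yes refl with split⇒subset p (length T) (subst (λ U → Split U d e) (sym (proj₂ (∷-injective eq))) split)
...   | I , ∏I≡d , ∏∁I≡e = I , subst₂ _∣_ (sym (proj₁ (∷-injective eq))) (sym (cong₂ _+_ ∏I≡d ∏∁I≡e)) r∣d+e

-- A further successor is adjoined even after `k` is reached: the path to `k` may be empty, and
-- every stage has to lengthen the list for the sequence to be infinite.
extend : ∀ k {S} → All Prime S → ∃ λ T → S ⟶* T × length S < length T × (Prime k → k ∈ˡ T)
extend k {S} S-prime with prime? k
... | no ¬k-prime with successor-exists S-prime
...   | r , succ = r ∷ S , grow done succ , ℕ.≤-refl , (λ k-prime → contradiction k-prime ¬k-prime)
extend k {S} S-prime | yes k-prime with reach-prime k-prime S-prime
... | T , path , k∈T with successor-exists (⟶*-primes S-prime path)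
...   | r , succ = r ∷ T , grow path succ , s≤s (⟶*-length path) , (λ _ → there k∈T)

-- The infinite sequence as the limit of the finite stages.

module Limit {P : List ℕ} (P-prime : All Prime P) where

  -- Stage `suc k` takes care of the number `k`, so every prime gets its turn.
  stage : ℕ → ∃ λ S → P ⟶* S
  extension : ∀ k → ∃ λ T → proj₁ (stage k) ⟶* T × length (proj₁ (stage k)) < length T × (Prime k → k ∈ˡ T)

  stage zero    = P , done
  stage (suc k) = proj₁ (extension k) , ⟶*-trans (proj₂ (stage k)) (proj₁ (proj₂ (extension k)))

  extension k = extend k (⟶*-primes P-prime (proj₂ (stage k)))

  L : ℕ → List ℕ
  L = proj₁ ∘ stage

  L-monotone : ∀ k m → L k ⟶* L (m + k)
  L-monotone k zero    = done
  L-monotone k (suc m) = ⟶*-trans (L-monotone k m) (proj₁ (proj₂ (extension (m + k))))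

  k≤length-L : ∀ k → k ≤ length (L k)
  k≤length-L zero    = z≤n
  k≤length-L (suc k) = ℕ.≤-trans (s≤s (k≤length-L k)) (proj₁ (proj₂ (proj₂ (extension k))))

  -- By `k≤length-L`, stage `suc j` has more than `j` entries, so the junk value of `nth` never
  -- occurs.
  p : ℕ → ℕ
  p j = nth (L (suc j)) j

  L-≤ : ∀ {k l} → k ≤ l → L k ⟶* L l
  L-≤ {k} {l} k≤l = subst (λ i → L k ⟶* L i) (ℕ.m∸n+n≡m k≤l) (L-monotone k (l ∸ k))

  -- Of the stages `k` and `suc j` one extends the other, and both already have an entry at `j`.
  p≡nth : ∀ k {j} → j < length (L k) → p j ≡ nth (L k) j
  p≡nth k {j} j<L with ℕ.≤-total k (suc j)
  ... | inj₁ k≤1+j = nth-stable (L-≤ k≤1+j) j<L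
  ... | inj₂ 1+j≤k = sym (nth-stable (L-≤ 1+j≤k) (k≤length-L (suc j)))

  applyDownFrom-p : ∀ k → applyDownFrom p (length (L k)) ≡ L k
  applyDownFrom-p k = applyDownFrom-nth p (L k) (p≡nth k)

  p-prime : ∀ j → Prime (p j)
  p-prime j = All.lookup (⟶*-primes P-prime (proj₂ (stage (suc j))))
    (subst (p j ∈ˡ_) (applyDownFrom-p (suc j)) (∈-applyDownFrom⁺ p (k≤length-L (suc j))))

  p-isGeneralizedEuclidSequence : IsGeneralizedEuclidSequence P p
  p-isGeneralizedEuclidSequence = record
    { prime  = p-prime
    -- The sequence starts with `P` in reverse order, since the head of a list counts as its latest
    -- prime.
    ; begins = ↭-trans (↭-reflexive (sym (reverse-applyDownFrom p (length P))))
                 (↭-trans (↭-reverse _) (↭-reflexive (applyDownFrom-p 0)))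
    ; step   = λ j P≤j → ⟶*-step p (proj₂ (stage (suc j))) (applyDownFrom-p (suc j)) P≤j (k≤length-L (suc j))
    }

  p-contains : ∀ q → Prime q → ∃ λ i → p i ≡ q
  p-contains q q-prime with ∈-applyDownFrom⁻ p
    (subst (q ∈ˡ_) (sym (applyDownFrom-p (suc q))) (proj₂ (proj₂ (proj₂ (extension q))) q-prime))
  ... | i , _ , q≡pi = i , sym q≡pi

theorem1 : (P : List ℕ) → Unique P → All Prime P →
    ∃ λ (p : ℕ → ℕ) →
    IsGeneralizedEuclidSequence P p ×
    (∀ (q : ℕ) → Prime q → ∃ λ (i : ℕ) → p i ≡ q)
theorem1 P _ P-prime = p , p-isGeneralizedEuclidSequence , p-contains
  where open Limit P-prime
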